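{- Let $n,\Delta,\sigma$ be nonnegative integers. There exists an edge-colored, unweighted, undirected graph $G=(V,E)$ with $\Theta(n)$ vertices, in which every color class has at most $\Delta$ edges, and a source set $S\subseteq V$ with $|S|=\sigma$, such that every $1$-CFT $S\times V$ distance preserver of $G$ has \[ \Omega\Big( n^{2-\frac{1}{\Delta+1}} \cdot \sigma^{\frac{1}{\Delta+1}} \cdot \tfrac{1}{\Delta}\Big)\text{ edges.} \]
   Context: An edge-colored graph assigns each edge exactly one color, with no restrictions; a color class is the set of edges of one color. For a color $c$, $G-c$ denotes $G$ with all edges of color $c$ deleted. A subgraph $H\subseteq G$ is a $1$-CFT $S\times V$ distance preserver if for every color $c$, every $s\in S$ and every $t\in V$, the distance from $s$ to $t$ in $H-c$ equals that in $G-c$.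
   Formalization: The formal theorem assumes Δ ≥ 1 and 1 ≤ σ ≤ n: for Δ = 0 the factor 1/Δ is undefined, for σ much larger than n no source set of size σ fits in Θ(n) vertices, and for σ = 0 the bound is trivially 0. -}

module Defs where

open import Data.Nat using (ℕ; zero; suc; _≤_; _≟_)
open import Data.Fin using (Fin)
open import Data.Fin.Subset using (Subset; _∈_; ∣_∣)
open import Data.List using (List; length; filter)
open import Data.List.Membership.Propositional renaming (_∈_ to _∈ᴸ_)
open import Data.List.Relation.Unary.All using (All)
open import Data.List.Relation.Unary.AllPairs using (AllPairs)
open import Data.List.Relation.Binary.Sublist.Propositional using (_⊆_)
open import Data.Product using (Σ; ∃; _×_; _,_)
open import Data.Sum using (_⊎_)
open import Relation.Binary.PropositionalEquality using (_≡_; _≢_)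
open import Relation.Nullary using (¬_)
open import Function.Bundles using (_⇔_)

record Edge (N : ℕ) : Set where
  constructor edge
  field
    u : Fin N
    v : Fin N
    col : ℕ
open Edge public

Joins : ∀ {N} → Edge N → Fin N → Fin N → Set
Joins e x y = (u e ≡ x × v e ≡ y) ⊎ (u e ≡ y × v e ≡ x)

SameEnds : ∀ {N} → Edge N → Edge N → Set
SameEnds e f = Joins f (u e) (v e)

record ColoredGraph : Set where
  constructor graph
  field
    N : ℕ
    E : List (Edge N)
    noLoops : All (λ e → u e ≢ v e) E
    simple  : AllPairs (λ e f → ¬ SameEnds e f) E
open ColoredGraph public

colorClassSize : ∀ {N} → List (Edge N) → ℕ → ℕ
colorClassSize L c = length (filter (λ e → col e ≟ c) L)

data Walk {N : ℕ} (L : List (Edge N)) (c : ℕ) : Fin N → Fin N → ℕ → Set where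
  here : ∀ {x} → Walk L c x x 0
  step : ∀ {x y z k} (e : Edge N) → e ∈ᴸ L → col e ≢ c → Joins e x y →
         Walk L c y z k → Walk L c x z (suc k)

-- dist_{(V,L)-c}(x,y) ≤ k  (distance in ℕ ∪ {∞}; false for all k iff infinite)
DistLE : ∀ {N} → List (Edge N) → ℕ → Fin N → Fin N → ℕ → Set
DistLE L c x y k = ∃ λ j → j ≤ k × Walk L c x y j

-- H (given as a sub-list of the edges of G) is a 1-CFT S × V distance preserver:
-- for every color c, s ∈ S, t ∈ V, dist_{H-c}(s,t) = dist_{G-c}(s,t),
-- expressed as: for every k, dist_{H-c}(s,t) ≤ k iff dist_{G-c}(s,t) ≤ k.
IsCFTPreserver : (G : ColoredGraph) → Subset (N G) → List (Edge (N G)) → Set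
IsCFTPreserver G S H =
  ∀ (c : ℕ) (s t : Fin (N G)) → s ∈ S → ∀ (k : ℕ) → DistLE H c s t k ⇔ DistLE (E G) c s t k

{-# OPTIONS --safe #-}

-- Each source s is the root of a tree with leaves 0, …, L-1 whose depths strictly decrease, and every leaf is
-- joined to each of n targets. Colour j is placed so that its failure cuts off exactly the leaves after j;
-- then j is the unique closest leaf, every shortest path from s to a target x runs through the edge between
-- leaf j and x, and a preserver must contain all σ L n such edges.
-- The tree is the f-fault lower bound tree of Parter: its leaves are words of length f ≤ Δ over D letters, and
-- at each level a rail with hanging subtrees is cut at one place. A rail edge that would serve several leaves is
-- subdivided into one edge per leaf, so that a colour has a single edge per level. Rails and connectors
-- of one level have O(D L) vertices; hence L may be of order n / (σ Δ D), where D is about (n/σ)^(1/(Δ+1)).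
module Submission where

open import Defs
open import Data.Bool using (Bool; true; false; not; _∧_; if_then_else_)
open import Data.Bool.Properties using (T-≡)
open import Data.Empty using (⊥)
open import Data.Fin using (Fin; toℕ; fromℕ<)
import Data.Fin as Fin
import Data.Fin.Properties as Fin
open import Data.Fin.Subset using (Subset; _∈_; ∣_∣)
open import Data.List using (List; []; _∷_; length; filter; tabulate; allFin; lookup)
open import Data.List.Membership.Propositional renaming (_∈_ to _∈ᴸ_)
open import Data.List.Membership.Propositional.Properties using (∈-tabulate⁺; ∈-tabulate⁻; ∈-lookup)
open import Data.List.Relation.Binary.Sublist.Propositional using (_⊆_)
open import Data.List.Relation.Binary.Sublist.Propositional.Properties using (Any-resp-⊆)
open import Data.List.Relation.Unary.All using (All; []; _∷_)
import Data.List.Relation.Unary.All as All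
import Data.List.Relation.Unary.All.Properties as All
open import Data.List.Relation.Unary.AllPairs using ([]; _∷_)
import Data.List.Relation.Unary.AllPairs.Properties as AllPairs
open import Data.List.Relation.Unary.Any using (index)
open import Data.List.Relation.Unary.Any.Properties using (lookup-index)
open import Data.List.Relation.Unary.Unique.Propositional using (Unique)
import Data.List.Relation.Unary.Unique.Propositional.Properties as Unique
open import Data.Maybe using (Maybe; just; nothing)
import Data.Maybe as Maybe
open import Data.Nat using (ℕ; zero; suc; _≤_; _<_; _*_; _+_; _^_; _⊓_; z≤n; s≤s; _≡ᵇ_; _≟_; _<?_; _≤?_; NonZero; >-nonZero)
open import Data.Nat.DivMod using (_/_; _%_; m≥n⇒m/n>0; m/n≡0⇒m<n; m/n*n≤m; m≡m%n+[m/n]*n; m%n<n; [m+kn]%n≡m%n; m<n⇒m%n≡m)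
open import Data.Nat.ListAction using (product)
open import Data.Nat.Properties
open import Data.Nat.Tactic.RingSolver using (solve-∀)
open import Data.Product using (Σ; ∃; _×_; _,_; proj₁; proj₂)
open import Data.Product.Function.NonDependent.Propositional using (_×-↔_)
open import Data.Sum using (_⊎_; inj₁; inj₂)
open import Data.Sum.Function.Propositional using (_⊎-↔_)
open import Data.Sum.Properties using (inj₂-injective)
open import Data.Unit using (⊤; tt)
open import Data.Vec using (replicate) renaming (_++_ to _++ᵛ_)
open import Data.Vec.Properties using (lookup-++ˡ; lookup-replicate; lookup⇒[]=)
open import Function using (_∘_; case_of_)
open import Function.Bundles using (_↔_; Inverse; Equivalence; mk↔ₛ′)
open import Function.Properties.Inverse using (↔-refl; ↔-sym; ↔-trans)
open import Relation.Binary.PropositionalEquality using (_≡_; _≢_; refl; sym; trans; cong; cong₂; subst; subst₂)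
open import Relation.Nullary using (¬_; Dec; yes; no; does; contradiction)
open import Relation.Nullary.Decidable using (_×-dec_)

-- Painted trees

-- up adds an edge above the root, plain or painted with a pair (colour , level); join identifies the two roots.
-- A leaf carries its label, a stub is a vertex that is not joined to the targets.
data Tree : Set where
  stub : Tree
  leaf : ℕ → Tree
  up   : Maybe (ℕ × ℕ) → Tree → Tree
  join : Tree → Tree → Tree

TreeEdge : Tree → Set
TreeEdge stub       = ⊥
TreeEdge (leaf _)   = ⊥
TreeEdge (up _ t)   = Maybe (TreeEdge t)
TreeEdge (join t u) = TreeEdge t ⊎ TreeEdge u

-- A vertex is the root (nothing) or the lower end of an edge.
Vertex : Tree → Set
Vertex t = Maybe (TreeEdge t)

size : Tree → ℕ
size stub       = 0
size (leaf _)   = 0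
size (up _ t)   = suc (size t)
size (join t u) = size t + size u

parent : ∀ t → TreeEdge t → Vertex t
parent (up c t)   nothing  = nothing
parent (up c t)   (just e) = just (parent t e)
parent (join t u) (inj₁ e) = Maybe.map inj₁ (parent t e)
parent (join t u) (inj₂ e) = Maybe.map inj₂ (parent u e)

paint : ∀ t → TreeEdge t → Maybe (ℕ × ℕ)
paint (up c t)   nothing  = c
paint (up c t)   (just e) = paint t e
paint (join t u) (inj₁ e) = paint t e
paint (join t u) (inj₂ e) = paint u e

depth : ∀ t → Vertex t → ℕ
depth t          nothing         = 0
depth (up c t)   (just w)        = suc (depth t w)
depth (join t u) (just (inj₁ e)) = depth t (just e)
depth (join t u) (just (inj₂ e)) = depth u (just e)

hits : ℕ → Maybe (ℕ × ℕ) → Bool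
hits m nothing        = false
hits m (just (c , _)) = c ≡ᵇ m

reached : ℕ → ∀ t → Vertex t → Bool
reached m t          nothing         = true
reached m (up c t)   (just w)        = not (hits m c) ∧ reached m t w
reached m (join t u) (just (inj₁ e)) = reached m t (just e)
reached m (join t u) (just (inj₂ e)) = reached m u (just e)

Leaf : Tree → Set
Leaf stub       = ⊥
Leaf (leaf _)   = ⊤
Leaf (up _ t)   = Leaf t
Leaf (join t u) = Leaf t ⊎ Leaf u

label : ∀ t → Leaf t → ℕ
label (leaf ℓ)   _        = ℓ
label (up c t)   w        = label t w
label (join t u) (inj₁ w) = label t w
label (join t u) (inj₂ w) = label u w

leafVertex : ∀ t → Leaf t → Vertex t
leafVertex (leaf ℓ)   _        = nothing
leafVertex (up c t)   w        = just (leafVertex t w)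
leafVertex (join t u) (inj₁ w) = Maybe.map inj₁ (leafVertex t w)
leafVertex (join t u) (inj₂ w) = Maybe.map inj₂ (leafVertex u w)

depth-inj₁ : ∀ t u w → depth (join t u) (Maybe.map inj₁ w) ≡ depth t w
depth-inj₁ t u nothing  = refl
depth-inj₁ t u (just _) = refl

depth-inj₂ : ∀ t u w → depth (join t u) (Maybe.map inj₂ w) ≡ depth u w
depth-inj₂ t u nothing  = refl
depth-inj₂ t u (just _) = refl

reached-inj₁ : ∀ m t u w → reached m (join t u) (Maybe.map inj₁ w) ≡ reached m t w
reached-inj₁ m t u nothing  = refl
reached-inj₁ m t u (just _) = refl

reached-inj₂ : ∀ m t u w → reached m (join t u) (Maybe.map inj₂ w) ≡ reached m u w
reached-inj₂ m t u nothing  = refl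
reached-inj₂ m t u (just _) = refl

-- `depth` and `reached` recurse downwards from the root, whereas walks in the graph follow
-- `parent`; this and `reached-parent` translate between the two.
depth-parent : ∀ t e → depth t (just e) ≡ suc (depth t (parent t e))
depth-parent (up c t)   nothing  = refl
depth-parent (up c t)   (just e) = cong suc (depth-parent t e)
depth-parent (join t u) (inj₁ e) = trans (depth-parent t e) (cong suc (sym (depth-inj₁ t u (parent t e))))
depth-parent (join t u) (inj₂ e) = trans (depth-parent u e) (cong suc (sym (depth-inj₂ t u (parent u e))))

∧-swap : ∀ a b c → a ∧ (b ∧ c) ≡ b ∧ (a ∧ c)
∧-swap true  b     c = refl
∧-swap false true  c = refl
∧-swap false false c = refl

reached-parent : ∀ m t e → reached m t (just e) ≡ not (hits m (paint t e)) ∧ reached m t (parent t e)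
reached-parent m (up c t)   nothing  = refl
reached-parent m (up c t)   (just e) =
  trans (cong (not (hits m c) ∧_) (reached-parent m t e))
        (∧-swap (not (hits m c)) (not (hits m (paint t e))) _)
reached-parent m (join t u) (inj₁ e) =
  trans (reached-parent m t e) (cong (_ ∧_) (sym (reached-inj₁ m t u (parent t e))))
reached-parent m (join t u) (inj₂ e) =
  trans (reached-parent m u e) (cong (_ ∧_) (sym (reached-inj₂ m t u (parent u e))))

-- The colours below o do not occur in the tree, hence the restriction in cut.
record Graded (o M : ℕ) (t : Tree) : Set where
  field
    depth+label : ∀ w → depth t (leafVertex t w) + label t w ≡ M + o
    o≤label     : ∀ w → o ≤ label t w
    survives    : ∀ w → reached (label t w) t (leafVertex t w) ≡ true
    cut         : ∀ w m → o ≤ m → reached m t (leafVertex t w) ≡ true → label t w ≤ m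
open Graded

graded-leaf : ∀ o → Graded o 0 (leaf o)
graded-leaf o = record
  { depth+label = λ _ → refl
  ; o≤label     = λ _ → ≤-refl
  ; survives    = λ _ → refl
  ; cut         = λ _ _ o≤m _ → o≤m
  }

graded-stub : ∀ o M → Graded o M stub
graded-stub o M = record { depth+label = λ () ; o≤label = λ () ; survives = λ () ; cut = λ () }

graded-plain : ∀ {o M t} → Graded o M t → Graded o (suc M) (up nothing t)
graded-plain g = record
  { depth+label = λ w → cong suc (depth+label g w)
  ; o≤label     = o≤label g
  ; survives    = survives g
  ; cut         = cut g
  }

≡ᵇ-refl : ∀ n → (n ≡ᵇ n) ≡ true
≡ᵇ-refl zero    = refl
≡ᵇ-refl (suc n) = ≡ᵇ-refl n

≢⇒≡ᵇ : ∀ {m n} → m ≢ n → (m ≡ᵇ n) ≡ false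
≢⇒≡ᵇ {m} {n} m≢n with m ≡ᵇ n in eq
... | false = refl
... | true  = contradiction (≡ᵇ⇒≡ m n (Equivalence.from T-≡ eq)) m≢n

-- The new edge adds one to each depth and the base drops from `suc o` to `o`; together they account
-- for the `2`. Colour `o` cuts off every leaf, as all labels are at least `suc o`.
graded-painted : ∀ {o M t} l → Graded (suc o) M t → Graded o (2 + M) (up (just (o , l)) t)
graded-painted {o} {M} {t} l g = record
  { depth+label = λ w → cong suc (trans (depth+label g w) (+-suc M o))
  ; o≤label     = λ w → <⇒≤ (o≤label g w)
  ; survives    = λ w → cong₂ _∧_ (cong not (≢⇒≡ᵇ (<⇒≢ (o≤label g w)))) (survives g w)
  ; cut         = cut′
  }
  where
  cut′ : ∀ w m → o ≤ m → not (o ≡ᵇ m) ∧ reached m t (leafVertex t w) ≡ true → label t w ≤ m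
  cut′ w m o≤m eq with o ≟ m
  ... | yes refl = case subst (λ b → not b ∧ reached o t (leafVertex t w) ≡ true) (≡ᵇ-refl o) eq of λ ()
  ... | no o≢m   = cut g w m (≤∧≢⇒< o≤m o≢m)
                     (subst (λ b → not b ∧ reached m t (leafVertex t w) ≡ true) (≢⇒≡ᵇ o≢m) eq)

graded-join : ∀ {o M t u} → Graded o M t → Graded o M u → Graded o M (join t u)
graded-join {o} {M} {t} {u} g h = record
  { depth+label = λ { (inj₁ w) → trans (cong (_+ label t w) (depth-inj₁ t u (leafVertex t w))) (depth+label g w)
                    ; (inj₂ w) → trans (cong (_+ label u w) (depth-inj₂ t u (leafVertex u w))) (depth+label h w) }
  ; o≤label     = λ { (inj₁ w) → o≤label g w ; (inj₂ w) → o≤label h w }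
  ; survives    = λ { (inj₁ w) → trans (reached-inj₁ (label t w) t u (leafVertex t w)) (survives g w)
                    ; (inj₂ w) → trans (reached-inj₂ (label u w) t u (leafVertex u w)) (survives h w) }
  ; cut         = λ { (inj₁ w) m o≤m r → cut g w m o≤m (trans (sym (reached-inj₁ m t u (leafVertex t w))) r)
                    ; (inj₂ w) m o≤m r → cut h w m o≤m (trans (sym (reached-inj₂ m t u (leafVertex u w))) r) }
  }

-- An index (colour , level) determines the edge; this bounds the colour classes by the number of levels.
record Rainbow (o h f : ℕ) (t : Tree) : Set where
  field
    bounds : ∀ e c l → paint t e ≡ just (c , l) → o ≤ c × c < h × l < f
    unique : ∀ e e′ c l → paint t e ≡ just (c , l) → paint t e′ ≡ just (c , l) → e ≡ e′
open Rainbow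

rainbow-stub : ∀ {o h f} → Rainbow o h f stub
rainbow-stub = record { bounds = λ () ; unique = λ () }

rainbow-leaf : ∀ {o h f ℓ} → Rainbow o h f (leaf ℓ)
rainbow-leaf = record { bounds = λ () ; unique = λ () }

rainbow-widen : ∀ {o o′ h h′ f f′ t} → o′ ≤ o → h ≤ h′ → f ≤ f′ → Rainbow o h f t → Rainbow o′ h′ f′ t
rainbow-widen p q r g = record
  { bounds = λ e c l eq → let (a , b , d) = bounds g e c l eq in
                          ≤-trans p a , <-≤-trans b q , <-≤-trans d r
  ; unique = unique g
  }

rainbow-plain : ∀ {o h f t} → Rainbow o h f t → Rainbow o h f (up nothing t)
rainbow-plain g = record
  { bounds = λ { (just e) → bounds g e }
  ; unique = λ { (just e) (just e′) c l p q → cong just (unique g e e′ c l p q) }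
  }

-- The colours below the new edge start at `suc o`, so its index cannot recur.
rainbow-painted : ∀ {o h f l t} → o < h → l < f → Rainbow (suc o) h f t → Rainbow o h f (up (just (o , l)) t)
rainbow-painted {o} o<h l<f g = record
  { bounds = λ { nothing c l refl → ≤-refl , o<h , l<f
               ; (just e) c l eq → let (a , b , d) = bounds g e c l eq in <⇒≤ a , b , d }
  ; unique = λ { nothing nothing c l p q → refl
               ; nothing (just e) c l refl q → contradiction (proj₁ (bounds g e c l q)) (n≮n o)
               ; (just e) nothing c l p refl → contradiction (proj₁ (bounds g e c l p)) (n≮n o)
               ; (just e) (just e′) c l p q → cong just (unique g e e′ c l p q) }
  }

rainbow-join : ∀ {o h f t u} → Rainbow o h f t → Rainbow o h f u →
               (∀ e e′ c l → paint t e ≡ just (c , l) → paint u e′ ≢ just (c , l)) →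
               Rainbow o h f (join t u)
rainbow-join g h disj = record
  { bounds = λ { (inj₁ e) → bounds g e ; (inj₂ e) → bounds h e }
  ; unique = λ { (inj₁ e) (inj₁ e′) c l p q → cong inj₁ (unique g e e′ c l p q)
               ; (inj₁ e) (inj₂ e′) c l p q → contradiction q (disj e e′ c l p)
               ; (inj₂ e) (inj₁ e′) c l p q → contradiction p (disj e′ e c l q)
               ; (inj₂ e) (inj₂ e′) c l p q → cong inj₂ (unique h e e′ c l p q) }
  }

-- `Graded` holds vacuously of a tree without leaves, so the existence of a leaf for each label is
-- tracked separately.
HasLeaf : Tree → ℕ → Set
HasLeaf t ℓ = Σ (Leaf t) λ w → label t w ≡ ℓ

-- The fault tree

connector : ℕ → Tree → Tree
connector zero    t = t
connector (suc n) t = up nothing (connector n t)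

rail : ℕ → ℕ → ℕ → Tree → Tree
rail l o zero    t = t
rail l o (suc n) t = up (just (o , l)) (rail l (suc o) n t)

-- Against rails of length L, connectors that shorten by 2 * L from one subtree to the next
-- make the depth drop by one from each leaf to the next.
comb : (ℕ → Tree) → ℕ → ℕ → ℕ → ℕ → Tree
comb T L l zero    o = stub
comb T L l (suc k) o = join (connector (2 * L * suc k) (T o)) (rail l o L (comb T L l k (o + L)))

-- The leaves are the words with digits bounded by the entries of the list, numbered consecutively
-- from `o`. A rail has level `length ks`, above all levels inside the subtrees `faultTree ks`.
faultTree : List ℕ → ℕ → Tree
faultTree []       o = leaf o
faultTree (k ∷ ks) o = comb (faultTree ks) (product ks) (length ks) k o

-- The depth of the first leaf, whose path takes the leading connector at every level.
leafDepth : List ℕ → ℕ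
leafDepth []       = 0
leafDepth (k ∷ ks) = 2 * product ks * k + leafDepth ks

graded-connector : ∀ {o M t} n → Graded o M t → Graded o (n + M) (connector n t)
graded-connector zero    g = g
graded-connector (suc n) g = graded-plain (graded-connector n g)

graded-rail : ∀ {l o M t} n → Graded (o + n) M t → Graded o (2 * n + M) (rail l o n t)
graded-rail {o = o} {M} {t} zero g = subst (λ z → Graded z M t) (+-identityʳ o) g
graded-rail {l} {o} {M} {t} (suc n) g =
  subst (λ z → Graded o z (rail l o (suc n) t)) (cong suc (cong (_+ M) (sym (+-suc n (n + 0)))))
    (graded-painted l (graded-rail n (subst (λ z → Graded z M t) (+-suc o n) g)))

-- The rail contributes `2 * L`, one for each edge and one for each label passed; this is the excess
-- of a connector over the next one, so both branches of the join get the same constant.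
graded-comb : ∀ {T L l M} → (∀ o → Graded o M (T o)) → ∀ k o → Graded o (2 * L * k + M) (comb T L l k o)
graded-comb g zero    o = graded-stub o _
graded-comb {T} {L} {l} {M} g (suc k) o =
  graded-join (graded-connector (2 * L * suc k) (g o))
    (subst (λ z → Graded o z (rail l o L (comb T L l k (o + L)))) (eq L k M)
      (graded-rail L (graded-comb g k (o + L))))
  where
  eq : ∀ L k M → 2 * L + (2 * L * k + M) ≡ 2 * L * suc k + M
  eq = solve-∀

graded-faultTree : ∀ ks o → Graded o (leafDepth ks) (faultTree ks o)
graded-faultTree []       = graded-leaf
graded-faultTree (k ∷ ks) = graded-comb (graded-faultTree ks) k

rainbow-connector : ∀ {o h f t} n → Rainbow o h f t → Rainbow o h f (connector n t)
rainbow-connector zero    g = g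
rainbow-connector (suc n) g = rainbow-plain (rainbow-connector n g)

rainbow-rail : ∀ {l o h f t} n → l < f → o + n ≤ h → Rainbow (o + n) h f t → Rainbow o h f (rail l o n t)
rainbow-rail {o = o} {h} {f} {t} zero l<f p g = subst (λ z → Rainbow z h f t) (+-identityʳ o) g
rainbow-rail {o = o} {h} {f} {t} (suc n) l<f p g =
  rainbow-painted (≤-trans (s≤s (m≤m+n o n)) p′) l<f
    (rainbow-rail n l<f p′ (subst (λ z → Rainbow z h f t) (+-suc o n) g))
  where
  p′ : suc o + n ≤ h
  p′ = subst (_≤ h) (+-suc o n) p

paint-connector : ∀ n t e {x} → paint (connector n t) e ≡ just x → Σ (TreeEdge t) λ e′ → paint t e′ ≡ just x
paint-connector zero    t e        eq = e , eq
paint-connector (suc n) t (just e) eq = paint-connector n t e eq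

paint-rail : ∀ l o n t e {x} → paint (rail l o n t) e ≡ just x →
             proj₂ x ≡ l ⊎ Σ (TreeEdge t) λ e′ → paint t e′ ≡ just x
paint-rail l o zero    t e        eq   = inj₂ (e , eq)
paint-rail l o (suc n) t nothing  refl = inj₁ refl
paint-rail l o (suc n) t (just e) eq   = paint-rail l (suc o) n t e eq

-- The level separates the first subtree from the rail. The colour separates it from all later
-- parts: below `o + L` in the former, at least `o + L` in the latter.
rainbow-comb : ∀ {T L f} → (∀ o → Rainbow o (o + L) f (T o)) →
               ∀ k o → Rainbow o (o + k * L) (suc f) (comb T L f k o)
rainbow-comb g zero o = rainbow-stub
rainbow-comb {T} {L} {f} g (suc k) o =
  rainbow-join
    (rainbow-connector (2 * L * suc k) (rainbow-widen ≤-refl (+-monoʳ-≤ o (m≤m+n L _)) (n≤1+n f) (g o)))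
    (rainbow-rail L ≤-refl (+-monoʳ-≤ o (m≤m+n L _)) rest)
    disjoint
  where
  rest : Rainbow (o + L) (o + suc k * L) (suc f) (comb T L f k (o + L))
  rest = rainbow-widen ≤-refl (≤-reflexive (+-assoc o L (k * L))) ≤-refl (rainbow-comb g k (o + L))

  disjoint : ∀ e e′ c l → paint (connector (2 * L * suc k) (T o)) e ≡ just (c , l) →
             paint (rail f o L (comb T L f k (o + L))) e′ ≢ just (c , l)
  disjoint e e′ c l p q with paint-connector _ _ e p
  ... | (d , p′) with bounds (g o) d c l p′ | paint-rail f o L _ e′ q
  ... | (_ , _ , l<f)   | inj₁ refl      = n≮n f l<f
  ... | (_ , c<o+L , _) | inj₂ (d′ , q′) = <⇒≱ c<o+L (proj₁ (bounds rest d′ c l q′))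

rainbow-faultTree : ∀ ks o → Rainbow o (o + product ks) (length ks) (faultTree ks o)
rainbow-faultTree []       o = rainbow-leaf
rainbow-faultTree (k ∷ ks) o = rainbow-comb (rainbow-faultTree ks) k o

hasLeaf-connector : ∀ {t ℓ} n → HasLeaf t ℓ → HasLeaf (connector n t) ℓ
hasLeaf-connector zero    h = h
hasLeaf-connector (suc n) h = hasLeaf-connector n h

hasLeaf-rail : ∀ {l o t ℓ} n → HasLeaf t ℓ → HasLeaf (rail l o n t) ℓ
hasLeaf-rail zero    h = h
hasLeaf-rail (suc n) h = hasLeaf-rail n h

hasLeaf-comb : ∀ {T L l} → (∀ o ℓ → o ≤ ℓ → ℓ < o + L → HasLeaf (T o) ℓ) →
               ∀ k o ℓ → o ≤ ℓ → ℓ < o + k * L → HasLeaf (comb T L l k o) ℓ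
hasLeaf-comb h zero o ℓ o≤ℓ ℓ<o = contradiction o≤ℓ (<⇒≱ (subst (ℓ <_) (+-identityʳ o) ℓ<o))
hasLeaf-comb {T} {L} {l} h (suc k) o ℓ o≤ℓ ℓ<hi with ℓ <? o + L
... | yes ℓ<o+L = let (w , eq) = hasLeaf-connector (2 * L * suc k) (h o ℓ o≤ℓ ℓ<o+L) in inj₁ w , eq
... | no  ℓ≮o+L = let (w , eq) = hasLeaf-rail {l} {o} L (hasLeaf-comb h k (o + L) ℓ (≮⇒≥ ℓ≮o+L)
                                    (subst (ℓ <_) (sym (+-assoc o L (k * L))) ℓ<hi))
                  in inj₂ w , eq

hasLeaf-faultTree : ∀ ks o ℓ → o ≤ ℓ → ℓ < o + product ks → HasLeaf (faultTree ks o) ℓ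
hasLeaf-faultTree []       o ℓ o≤ℓ ℓ<o+1 = tt , ≤-antisym o≤ℓ (m<1+n⇒m≤n (subst (ℓ <_) (+-comm o 1) ℓ<o+1))
hasLeaf-faultTree (k ∷ ks) = hasLeaf-comb (hasLeaf-faultTree ks) k

size-connector : ∀ n t → size (connector n t) ≡ n + size t
size-connector zero    t = refl
size-connector (suc n) t = cong suc (size-connector n t)

size-rail : ∀ l o n t → size (rail l o n t) ≡ n + size t
size-rail l o zero    t = refl
size-rail l o (suc n) t = cong suc (size-rail l (suc o) n t)

-- Each of the `k` steps costs one subtree, a rail of `L` edges and a connector of at most
-- `2 * L * D` edges.
size-comb : ∀ {T L l D s} → (∀ o → size (T o) ≤ s) → ∀ k o → k ≤ D →
            size (comb T L l k o) ≤ k * (s + L * suc (2 * D))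
size-comb h zero o k≤D = z≤n
size-comb {T} {L} {l} {D} {s} h (suc k) o k<D = begin
  size (connector (2 * L * suc k) (T o)) + size (rail l o L rest)
    ≡⟨ cong₂ _+_ (size-connector (2 * L * suc k) (T o)) (size-rail l o L rest) ⟩
  (2 * L * suc k + size (T o)) + (L + size rest)
    ≤⟨ +-mono-≤ (+-mono-≤ (*-monoʳ-≤ (2 * L) k<D) (h o)) (+-monoʳ-≤ L (size-comb h k (o + L) (<⇒≤ k<D))) ⟩
  (2 * L * D + s) + (L + k * (s + L * suc (2 * D)))
    ≡⟨ eq L D s k ⟩
  suc k * (s + L * suc (2 * D)) ∎
  where
  open ≤-Reasoning
  rest = comb T L l k (o + L)
  eq : ∀ L D s k → (2 * L * D + s) + (L + k * (s + L * suc (2 * D))) ≡ suc k * (s + L * suc (2 * D))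
  eq = solve-∀

-- Every level contributes at most `product ks * suc (2 * D)` edges, since the number of copies of a
-- subtree makes up for its fewer leaves.
size-faultTree : ∀ {D} ks o → All (_≤ D) ks → size (faultTree ks o) ≤ length ks * product ks * suc (2 * D)
size-faultTree [] o [] = z≤n
size-faultTree {D} (k ∷ ks) o (k≤D ∷ ks≤D) =
  subst (size (faultTree (k ∷ ks) o) ≤_) (eq k (length ks) (product ks) D)
    (size-comb (λ o′ → size-faultTree ks o′ ks≤D) k o k≤D)
  where
  eq : ∀ k f p D → k * (f * p * suc (2 * D) + p * suc (2 * D)) ≡ suc f * (k * p) * suc (2 * D)
  eq = solve-∀

-- Choice of the parameters

^-distribʳ-* : ∀ m n k → (m * n) ^ k ≡ m ^ k * n ^ k
^-distribʳ-* m n zero    = refl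
^-distribʳ-* m n (suc k) = trans (cong (m * n *_) (^-distribʳ-* m n k)) (eq m n (m ^ k) (n ^ k))
  where
  eq : ∀ a b c d → a * b * (c * d) ≡ a * c * (b * d)
  eq = solve-∀

-- Search downwards for the least positive base that still satisfies the lower bound. When `suc d`
-- fails, the answer is `suc (suc d)`, at most twice `suc d`, whence the factor `2 ^ k`.
approximate-root : ∀ {σ n} k d → σ ≤ n → n ≤ σ * suc d ^ k →
                   ∃ λ D′ → 1 ≤ D′ × n ≤ σ * D′ ^ k × σ * D′ ^ k ≤ 2 ^ k * n
approximate-root {σ} {n} k zero σ≤n n≤ = 1 , ≤-refl , n≤ , (begin
  σ * 1 ^ k ≡⟨ cong (σ *_) (^-zeroˡ k) ⟩
  σ * 1     ≡⟨ *-identityʳ σ ⟩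
  σ         ≤⟨ σ≤n ⟩
  n         ≤⟨ m≤n*m n (2 ^ k) {{m^n≢0 2 k}} ⟩
  2 ^ k * n ∎)
  where open ≤-Reasoning
approximate-root {σ} {n} k (suc d) σ≤n n≤ with n ≤? σ * suc d ^ k
... | yes n≤′ = approximate-root k d σ≤n n≤′
... | no  n≰  = suc (suc d) , s≤s z≤n , n≤ , (begin
  σ * suc (suc d) ^ k       ≤⟨ *-monoʳ-≤ σ (^-monoˡ-≤ k double) ⟩
  σ * (2 * suc d) ^ k       ≡⟨ cong (σ *_) (^-distribʳ-* 2 (suc d) k) ⟩
  σ * (2 ^ k * suc d ^ k)   ≡⟨ eq σ (2 ^ k) (suc d ^ k) ⟩
  2 ^ k * (σ * suc d ^ k)   ≤⟨ *-monoʳ-≤ (2 ^ k) (<⇒≤ (≰⇒> n≰)) ⟩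
  2 ^ k * n                 ∎)
  where
  open ≤-Reasoning
  double : suc (suc d) ≤ 2 * suc d
  double = subst (suc (suc d) ≤_) (cong suc (sym (+-suc d (d + 0)))) (s≤s (s≤s (m≤m+n d (d + 0))))
  eq : ∀ a b c → a * (b * c) ≡ b * (a * c)
  eq = solve-∀

-- The weight w is the place value of the leading digit, so rounding T down to that digit loses at most a factor 2.
round-down : ∀ D → 1 ≤ D → ∀ f T → 1 ≤ T → T ≤ D ^ suc f →
             ∃ λ ks → All (_≤ D) ks × length ks ≤ suc f × product ks ≤ T ×
             ∃ λ w → w ≤ product ks × T < product ks + w
round-down D 1≤D f T 1≤T T≤ with T ≤? D
... | yes T≤D = T ∷ [] , T≤D ∷ [] , s≤s z≤n , ≤-reflexive (*-identityʳ T) , 1 ,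
                subst (1 ≤_) (sym (*-identityʳ T)) 1≤T ,
                ≤-reflexive (trans (+-comm 1 T) (cong (_+ 1) (sym (*-identityʳ T))))
round-down D 1≤D zero    T 1≤T T≤ | no T≰D = contradiction (subst (T ≤_) (*-identityʳ D) T≤) T≰D
round-down D@(suc _) 1≤D (suc f) T 1≤T T≤ | no T≰D
  with round-down D 1≤D f (T / D)
         (m≥n⇒m/n>0 (<⇒≤ (≰⇒> T≰D)))
         (*-cancelʳ-≤ (T / D) (D ^ suc f) D
           (≤-trans (m/n*n≤m T D) (≤-trans T≤ (≤-reflexive (*-comm D (D ^ suc f))))))
... | ks , ks≤D , len , p≤ , w , w≤ , T/D< =
  -- All digits but the innermost have the full base `D`; only the innermost is adjusted to `T`.
  D ∷ ks , ≤-refl ∷ ks≤D , s≤s len ,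
  (begin
    D * product ks ≤⟨ *-monoʳ-≤ D p≤ ⟩
    D * (T / D)    ≡⟨ *-comm D (T / D) ⟩
    T / D * D      ≤⟨ m/n*n≤m T D ⟩
    T              ∎) ,
  D * w , *-monoʳ-≤ D w≤ ,
  (begin-strict
    T                        ≡⟨ m≡m%n+[m/n]*n T D ⟩
    T % D + T / D * D        <⟨ +-monoˡ-< (T / D * D) (m%n<n T D) ⟩
    suc (T / D) * D          ≤⟨ *-monoˡ-≤ D T/D< ⟩
    (product ks + w) * D     ≡⟨ *-comm (product ks + w) D ⟩
    D * (product ks + w)     ≡⟨ *-distribˡ-+ D (product ks) w ⟩
    D * product ks + D * w   ∎)
  where open ≤-Reasoning

-- `room` keeps the `σ` copies of the tree within `3 * n` edges, `dense` makes the number of leaves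
-- of order at least `n / (σ Δ D)`, and `D-small` bounds `D` by twice the root of order `Δ + 1` of
-- `n / σ`.
record Parameters (n Δ σ : ℕ) : Set where
  field
    D        : ℕ
    ks       : List ℕ
    ks≤D     : All (_≤ D) ks
    len≤Δ    : length ks ≤ Δ
    room     : σ * (length ks * product ks * suc (2 * D)) ≤ 3 * n
    dense    : n ≤ 4 * product ks * (σ * Δ * D)
    D-small  : σ * D ^ (Δ + 1) ≤ 2 ^ (Δ + 1) * n

parameters : ∀ n Δ σ → 1 ≤ Δ → 1 ≤ σ → σ ≤ n → Parameters n Δ σ
parameters n@(suc n-1) (suc f) σ@(suc _) 1≤Δ 1≤σ σ≤n
  -- The search may start at the base `n`, which is large enough.
  with approximate-root (suc f + 1) n-1 σ≤n
         (≤-trans (m≤m*n n (n ^ (f + 1)) {{m^n≢0 n (f + 1)}}) (m≤n*m (n ^ (suc f + 1)) σ))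
... | D@(suc _) , 1≤D , n≤ , D-small with n / (σ * suc f * D) in T-eq
-- Here `n < σ * Δ * D`, and a single leaf at the root is dense enough.
... | zero = record
  { D = D ; ks = [] ; ks≤D = [] ; len≤Δ = z≤n ; D-small = D-small
  ; room  = subst (_≤ 3 * n) (sym (*-zeroʳ σ)) z≤n
  ; dense = ≤-trans (<⇒≤ (m/n≡0⇒m<n T-eq)) (m≤n*m (σ * suc f * D) 4)
  }
-- `T` is the number of leaves to aim for; `T * (σ * D) ≤ n ≤ σ * D ^ (Δ + 1)` shows that words of
-- length `Δ` suffice for them.
... | T@(suc _)
  with round-down D 1≤D f T (s≤s z≤n)
         (*-cancelʳ-≤ T (D ^ suc f) (σ * D) (begin
           T * (σ * D)                   ≤⟨ *-monoʳ-≤ T (*-monoˡ-≤ D (m≤m*n σ (suc f))) ⟩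
           T * (σ * suc f * D)           ≤⟨ Tm≤n ⟩
           n                             ≤⟨ n≤ ⟩
           σ * D ^ (suc f + 1)           ≡⟨ cong (λ z → σ * D ^ z) (+-comm (suc f) 1) ⟩
           σ * (D * D ^ suc f)           ≡⟨ eq₁ σ D (D ^ suc f) ⟩
           D ^ suc f * (σ * D)           ∎))
  where
  open ≤-Reasoning
  Tm≤n : T * (σ * suc f * D) ≤ n
  Tm≤n = subst (λ z → z * (σ * suc f * D) ≤ n) T-eq (m/n*n≤m n (σ * suc f * D))
  eq₁ : ∀ a b c → a * (b * c) ≡ c * (a * b)
  eq₁ = solve-∀
... | ks , ks≤D , len , p≤T , w , w≤p , T<p+w = record
  { D = D ; ks = ks ; ks≤D = ks≤D ; len≤Δ = len ; D-small = D-small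
  ; room  = begin
      σ * (length ks * product ks * suc (2 * D)) ≤⟨ *-monoʳ-≤ σ (*-mono-≤ (*-mono-≤ len p≤T) 1+2D≤3D) ⟩
      σ * (suc f * T * (3 * D))                  ≡⟨ eq₂ σ (suc f) T D ⟩
      3 * (T * (σ * suc f * D))                  ≤⟨ *-monoʳ-≤ 3 Tm≤n ⟩
      3 * n                                      ∎
  ; dense = begin
      n                                          ≡⟨ m≡m%n+[m/n]*n n m ⟩
      n % m + n / m * m                          ≤⟨ +-monoˡ-≤ (n / m * m) (<⇒≤ (m%n<n n m)) ⟩
      suc (n / m) * m                            ≡⟨ cong (λ z → suc z * m) T-eq ⟩
      -- As `w` is at most the product, `suc T` is at most twice the product.
      suc T * m                                  ≤⟨ *-monoˡ-≤ m (≤-trans T<p+w (+-monoʳ-≤ (product ks) w≤p)) ⟩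
      (product ks + product ks) * m              ≤⟨ *-monoˡ-≤ m (≤-trans (m≤m+n (product ks + product ks) (2 * product ks)) (≤-reflexive (eq₃ (product ks)))) ⟩
      4 * product ks * m                         ∎
  }
  where
  open ≤-Reasoning
  m = σ * suc f * D
  Tm≤n : T * m ≤ n
  Tm≤n = subst (λ z → z * m ≤ n) T-eq (m/n*n≤m n m)
  1+2D≤3D : suc (2 * D) ≤ 3 * D
  1+2D≤3D = +-monoˡ-≤ (2 * D) 1≤D
  eq₂ : ∀ a b c d → a * (b * c * (3 * d)) ≡ 3 * (c * (a * b * d))
  eq₂ = solve-∀
  eq₃ : ∀ p → (p + p) + 2 * p ≡ 4 * p
  eq₃ = solve-∀

-- Density gives `n ^ 2 ≤ 4 * Δ * h * D`. Raising this to the power `Δ + 1` and multiplying by `σ`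
-- lets `D-small` eliminate `D`, at the price of a factor 2 inside the power and of one `n`, which
-- cancels.
edge-bound : ∀ {n Δ σ} (P : Parameters n Δ σ) → 1 ≤ n → ∀ {h} → σ * (product (Parameters.ks P) * n) ≤ h →
             n ^ (2 * Δ + 1) * σ ≤ (8 * Δ * h) ^ (Δ + 1)
edge-bound {n} {Δ} {σ} P 1≤n {h} many = *-cancelʳ-≤ _ _ n {{>-nonZero 1≤n}} (begin
  n ^ (2 * Δ + 1) * σ * n                      ≡⟨ eq₁ (n ^ (2 * Δ + 1)) σ n ⟩
  n * n ^ (2 * Δ + 1) * σ                      ≡⟨ cong (λ z → n ^ z * σ) (eq₂ Δ) ⟩
  n ^ (2 * (Δ + 1)) * σ                        ≡⟨ cong (_* σ) (^-*-assoc n 2 (Δ + 1)) ⟨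
  (n ^ 2) ^ (Δ + 1) * σ                        ≤⟨ *-monoˡ-≤ σ (^-monoˡ-≤ (Δ + 1) square) ⟩
  (4 * Δ * h * D) ^ (Δ + 1) * σ                ≡⟨ cong (_* σ) (^-distribʳ-* (4 * Δ * h) D (Δ + 1)) ⟩
  (4 * Δ * h) ^ (Δ + 1) * D ^ (Δ + 1) * σ      ≡⟨ eq₃ ((4 * Δ * h) ^ (Δ + 1)) (D ^ (Δ + 1)) σ ⟩
  (4 * Δ * h) ^ (Δ + 1) * (σ * D ^ (Δ + 1))    ≤⟨ *-monoʳ-≤ ((4 * Δ * h) ^ (Δ + 1)) D-small ⟩
  (4 * Δ * h) ^ (Δ + 1) * (2 ^ (Δ + 1) * n)    ≡⟨ *-assoc ((4 * Δ * h) ^ (Δ + 1)) (2 ^ (Δ + 1)) n ⟨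
  (4 * Δ * h) ^ (Δ + 1) * 2 ^ (Δ + 1) * n      ≡⟨ cong (_* n) (^-distribʳ-* (4 * Δ * h) 2 (Δ + 1)) ⟨
  (4 * Δ * h * 2) ^ (Δ + 1) * n                ≡⟨ cong (λ z → z ^ (Δ + 1) * n) (eq₄ Δ h) ⟩
  (8 * Δ * h) ^ (Δ + 1) * n                    ∎)
  where
  open ≤-Reasoning
  open Parameters P
  eq₁ : ∀ a b c → a * b * c ≡ c * a * b
  eq₁ = solve-∀
  eq₂ : ∀ Δ → suc (2 * Δ + 1) ≡ 2 * (Δ + 1)
  eq₂ = solve-∀
  eq₃ : ∀ a b c → a * b * c ≡ a * (c * b)
  eq₃ = solve-∀
  eq₄ : ∀ Δ h → 4 * Δ * h * 2 ≡ 8 * Δ * h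
  eq₄ = solve-∀
  eq₅ : ∀ n p s Δ D → n * (4 * p * (s * Δ * D)) ≡ 4 * Δ * (s * (p * n)) * D
  eq₅ = solve-∀
  square : n ^ 2 ≤ 4 * Δ * h * D
  square = begin
    n ^ 2                                 ≡⟨ cong (n *_) (*-identityʳ n) ⟩
    n * n                                 ≤⟨ *-monoʳ-≤ n dense ⟩
    n * (4 * product ks * (σ * Δ * D))    ≡⟨ eq₅ n (product ks) σ Δ D ⟩
    4 * Δ * (σ * (product ks * n)) * D    ≤⟨ *-monoˡ-≤ D (*-monoʳ-≤ (4 * Δ) many) ⟩
    4 * Δ * h * D                         ∎

-- Lists, walks and encodings

injective-members⇒≤ : ∀ {A : Set} {m} {xs : List A} (f : Fin m → A) →
                      (∀ {i j} → f i ≡ f j → i ≡ j) → (∀ i → f i ∈ᴸ xs) → m ≤ length xs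
injective-members⇒≤ {xs = xs} f f-inj f∈ = Fin.injective⇒≤ {f = λ i → index (f∈ i)} λ {i} {j} eq →
  f-inj (trans (lookup-index (f∈ i)) (trans (cong (lookup xs) eq) (sym (lookup-index (f∈ j)))))

unique-lookup : ∀ {A : Set} {xs : List A} → Unique xs → ∀ {i j} → lookup xs i ≡ lookup xs j → i ≡ j
unique-lookup (x∉ ∷ xs!) {Fin.zero}  {Fin.zero}  eq = refl
unique-lookup (x∉ ∷ xs!) {Fin.zero}  {Fin.suc j} eq = contradiction eq (All.lookup x∉ (∈-lookup j))
unique-lookup (x∉ ∷ xs!) {Fin.suc i} {Fin.zero}  eq = contradiction (sym eq) (All.lookup x∉ (∈-lookup i))
unique-lookup (x∉ ∷ xs!) {Fin.suc i} {Fin.suc j} eq = cong Fin.suc (unique-lookup xs! eq)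

-- Moves the count from values to indices, which are listed without repetition.
length-filter-tabulate : ∀ {A : Set} {P : A → Set} (P? : ∀ x → Dec (P x)) {m} (f : Fin m → A) →
  length (filter P? (tabulate f)) ≡ length (filter (P? ∘ f) (allFin m))
length-filter-tabulate P? {zero}  f = refl
length-filter-tabulate P? {suc m} f with does (P? (f Fin.zero))
... | true  = cong suc (trans (length-filter-tabulate P? (f ∘ Fin.suc)) (sym (length-filter-tabulate (P? ∘ f) Fin.suc)))
... | false = trans (length-filter-tabulate P? (f ∘ Fin.suc)) (sym (length-filter-tabulate (P? ∘ f) Fin.suc))

-- Within one colour, `level` is an injection into the numbers below `Δ`.
colorClassSize≤ : ∀ {N m Δ} (f : Fin m → Edge N) (level : Fin m → ℕ) → (∀ i → level i < Δ) →
                  (∀ i j → col (f i) ≡ col (f j) → level i ≡ level j → i ≡ j) →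
                  ∀ c → colorClassSize (tabulate f) c ≤ Δ
colorClassSize≤ {m = m} {Δ} f level level<Δ inj c =
  subst (_≤ Δ) (sym (length-filter-tabulate (λ e → col e ≟ c) f))
    (Fin.injective⇒≤ {f = λ p → fromℕ< (level<Δ (lookup ys p))} λ {p} {q} eq →
      unique-lookup ys! (inj _ _ (trans (col≡c p) (sym (col≡c q))) (Fin.fromℕ<-injective _ _ _ _ eq)))
  where
  c? = λ i → col (f i) ≟ c
  ys = filter c? (allFin m)
  ys! : Unique ys
  ys! = Unique.filter⁺ c? (Unique.allFin⁺ m)
  col≡c : ∀ p → col (f (lookup ys p)) ≡ c
  col≡c p = All.lookup (All.all-filter c? (allFin m)) (∈-lookup p)

_▷_ : ∀ {N L c} {x y z : Fin N} {k} → Walk L c x y k →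
      (Σ (Edge N) λ e → e ∈ᴸ L × col e ≢ c × Joins e y z) → Walk L c x z (suc k)
here             ▷ (e , e∈ , c≢ , j) = step e e∈ c≢ j here
step e e∈ c≢ j w ▷ last              = step e e∈ c≢ j (w ▷ last)

-- A potential that is 1-Lipschitz along all edges but e* bounds from below the length of every walk that avoids e*.
walk-uses : ∀ {N L c} {x y : Fin N} {k} (φ : Fin N → ℕ) (e* : Edge N) →
            (∀ e → e ∈ᴸ L → col e ≢ c → e ≡ e* ⊎ (φ (u e) ≤ suc (φ (v e)) × φ (v e) ≤ suc (φ (u e)))) →
            Walk L c x y k → e* ∈ᴸ L ⊎ φ y ≤ φ x + k
walk-uses φ e* lip here = inj₂ (m≤m+n _ 0)
walk-uses {x = x} {y} {suc k} φ e* lip (step e e∈ c≢ joins w) with lip e e∈ c≢ | walk-uses φ e* lip w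
... | inj₁ refl      | _       = inj₁ e∈
... | inj₂ _         | inj₁ q  = inj₁ q
... | inj₂ (uv , vu) | inj₂ le = inj₂ (≤-trans le (≤-trans (+-monoˡ-≤ k (descent joins)) (≤-reflexive (sym (+-suc (φ x) k)))))
  where
  descent : ∀ {z} → Joins e x z → φ z ≤ suc (φ x)
  descent (inj₁ (refl , refl)) = vu
  descent (inj₂ (refl , refl)) = uv

Maybe-↔ : ∀ {A : Set} {n} → A ↔ Fin n → Maybe A ↔ Fin (suc n)
Maybe-↔ {A} {n} A↔ = mk↔ₛ′ to from to∘from from∘to
  where
  to : Maybe A → Fin (suc n)
  to nothing  = Fin.zero
  to (just a) = Fin.suc (Inverse.to A↔ a)
  from : Fin (suc n) → Maybe A
  from Fin.zero    = nothing
  from (Fin.suc i) = just (Inverse.from A↔ i)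
  to∘from : ∀ i → to (from i) ≡ i
  to∘from Fin.zero    = refl
  to∘from (Fin.suc i) = cong Fin.suc (Inverse.strictlyInverseˡ A↔ i)
  from∘to : ∀ a → from (to a) ≡ a
  from∘to nothing  = refl
  from∘to (just a) = cong just (Inverse.strictlyInverseʳ A↔ a)

treeEdge↔ : ∀ t → TreeEdge t ↔ Fin (size t)
treeEdge↔ stub       = ↔-sym Fin.0↔⊥
treeEdge↔ (leaf _)   = ↔-sym Fin.0↔⊥
treeEdge↔ (up _ t)   = Maybe-↔ (treeEdge↔ t)
treeEdge↔ (join t u) = ↔-trans (treeEdge↔ t ⊎-↔ treeEdge↔ u) (↔-sym Fin.+↔⊎)

-- Gives each source its own palette: `i` is the residue modulo `σ` and `c` the quotient.
encode-colour : ∀ {σ} → Fin σ → ℕ → ℕ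
encode-colour {σ} i c = toℕ i + c * σ

encode-colour-injective : ∀ {σ} (i i′ : Fin σ) c c′ → encode-colour i c ≡ encode-colour i′ c′ → i ≡ i′ × c ≡ c′
encode-colour-injective {σ} i i′ c c′ eq = Fin.toℕ-injective i≡i′ , *-cancelʳ-≡ c c′ σ (+-cancelˡ-≡ (toℕ i′) _ _
  (trans (cong (_+ c * σ) (sym i≡i′)) eq))
  where
  instance
    σ≢0 : NonZero σ
    σ≢0 = Fin.nonZeroIndex i
  residue : ∀ (j : Fin σ) d → (toℕ j + d * σ) % σ ≡ toℕ j
  residue j d = trans ([m+kn]%n≡m%n (toℕ j) d σ) (m<n⇒m%n≡m (Fin.toℕ<n j))
  i≡i′ : toℕ i ≡ toℕ i′
  i≡i′ = trans (sym (residue i c)) (trans (cong (_% σ) eq) (residue i′ c′))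

∣replicate-true++false∣ : ∀ m n → ∣ replicate m true ++ᵛ replicate n false ∣ ≡ m
∣replicate-true++false∣ zero    zero    = refl
∣replicate-true++false∣ zero    (suc n) = ∣replicate-true++false∣ zero n
∣replicate-true++false∣ (suc m) n       = cong suc (∣replicate-true++false∣ m n)

-- The graph

module Construction (n σ L M h f : ℕ) (t : Tree) (graded : Graded 0 M t)
                    (hasLeaf : ∀ ℓ → ℓ < L → HasLeaf t ℓ) (rainbow : Rainbow 0 h f t) where

  leafAt : Fin L → Vertex t
  leafAt j = leafVertex t (proj₁ (hasLeaf (toℕ j) (Fin.toℕ<n j)))

  leafAt-depth : ∀ j → depth t (leafAt j) + toℕ j ≡ M
  leafAt-depth j with hasLeaf (toℕ j) (Fin.toℕ<n j)
  ... | w , eq = trans (cong (depth t (leafVertex t w) +_) (sym eq)) (trans (depth+label graded w) (+-identityʳ M))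

  leafAt-survives : ∀ j → reached (toℕ j) t (leafAt j) ≡ true
  leafAt-survives j with hasLeaf (toℕ j) (Fin.toℕ<n j)
  ... | w , eq = subst (λ ℓ → reached ℓ t (leafVertex t w) ≡ true) eq (survives graded w)

  leafAt-cut : ∀ j m → reached m t (leafAt j) ≡ true → toℕ j ≤ m
  leafAt-cut j m r with hasLeaf (toℕ j) (Fin.toℕ<n j)
  ... | w , eq = subst (_≤ m) eq (cut graded w m z≤n r)

  leafAt-injective : ∀ {j j′} → leafAt j ≡ leafAt j′ → j ≡ j′
  leafAt-injective {j} {j′} eq = Fin.toℕ-injective (+-cancelˡ-≡ (depth t (leafAt j′)) _ _
    (trans (cong (λ w → depth t w + toℕ j) (sym eq)) (trans (leafAt-depth j) (sym (leafAt-depth j′)))))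

  -- The roots come first, so that their codes form a prefix of `Fin order`, as `sources` requires.
  GVertex : Set
  GVertex = Fin σ ⊎ ((Fin σ × TreeEdge t) ⊎ Fin n)

  GEdge : Set
  GEdge = (Fin σ × TreeEdge t) ⊎ (Fin σ × Fin L × Fin n)

  rest order edges : ℕ
  rest  = σ * size t + n
  order = σ + rest
  edges = σ * size t + σ * (L * n)

  vertex↔ : GVertex ↔ Fin order
  vertex↔ = ↔-trans (↔-refl ⊎-↔ ↔-trans (↔-trans (↔-refl ×-↔ treeEdge↔ t) (↔-sym Fin.*↔×) ⊎-↔ ↔-refl) (↔-sym Fin.+↔⊎))
                    (↔-sym Fin.+↔⊎)

  edge↔ : GEdge ↔ Fin edges
  edge↔ = ↔-trans (↔-trans (↔-refl ×-↔ treeEdge↔ t) (↔-sym Fin.*↔×) ⊎-↔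
                   ↔-trans (↔-refl ×-↔ ↔-sym Fin.*↔×) (↔-sym Fin.*↔×))
                  (↔-sym Fin.+↔⊎)

  open Inverse vertex↔ using () renaming (to to encᵛ; from to decᵛ; strictlyInverseʳ to dec-encᵛ)
  open Inverse edge↔ using () renaming (to to encᵉ; from to decᵉ; strictlyInverseʳ to dec-encᵉ; strictlyInverseˡ to enc-decᵉ)

  encᵛ-injective : ∀ {x y} → encᵛ x ≡ encᵛ y → x ≡ y
  encᵛ-injective {x} {y} eq = trans (sym (dec-encᵛ x)) (trans (cong decᵛ eq) (dec-encᵛ y))

  encᵉ-injective : ∀ {x y} → encᵉ x ≡ encᵉ y → x ≡ y
  encᵉ-injective {x} {y} eq = trans (sym (dec-encᵉ x)) (trans (cong decᵉ eq) (dec-encᵉ y))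

  decᵉ-injective : ∀ {x y} → decᵉ x ≡ decᵉ y → x ≡ y
  decᵉ-injective {x} {y} eq = trans (sym (enc-decᵉ x)) (trans (cong encᵉ eq) (enc-decᵉ y))

  inTree : Fin σ → Vertex t → GVertex
  inTree i nothing  = inj₁ i
  inTree i (just e) = inj₂ (inj₁ (i , e))

  inTree-injective : ∀ {i i′ w w′} → inTree i w ≡ inTree i′ w′ → i ≡ i′ × w ≡ w′
  inTree-injective {w = nothing} {nothing} refl = refl , refl
  inTree-injective {w = just _}  {just _}  refl = refl , refl

  target : Fin n → GVertex
  target x = inj₂ (inj₂ x)

  lower upper : GEdge → GVertex
  lower (inj₁ (i , e))     = inTree i (just e)
  lower (inj₂ (i , j , x)) = target x
  upper (inj₁ (i , e))     = inTree i (parent t e)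
  upper (inj₂ (i , j , x)) = inTree i (leafAt j)

  -- Strictly increasing from the upper to the lower end of each edge, which excludes loops and
  -- reversed duplicates. Leaves have depth at most `M`, so `suc M` serves for the targets.
  height : GVertex → ℕ
  height (inj₁ i)              = 0
  height (inj₂ (inj₁ (i , e))) = depth t (just e)
  height (inj₂ (inj₂ x))       = suc M

  height-inTree : ∀ i w → height (inTree i w) ≡ depth t w
  height-inTree i nothing  = refl
  height-inTree i (just e) = refl

  upper<lower : ∀ e → height (upper e) < height (lower e)
  upper<lower (inj₁ (i , e))     = ≤-reflexive (trans (cong suc (height-inTree i (parent t e))) (sym (depth-parent t e)))
  upper<lower (inj₂ (i , j , x)) = s≤s (subst₂-≤ (height-inTree i (leafAt j)) (leafAt-depth j))
    where
    subst₂-≤ : ∀ {a b c} → a ≡ b → b + toℕ j ≡ c → a ≤ c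
    subst₂-≤ refl refl = m≤m+n _ _

  ends-injective : ∀ e e′ → lower e ≡ lower e′ → upper e ≡ upper e′ → e ≡ e′
  ends-injective (inj₁ _) (inj₁ _) refl _ = refl
  ends-injective (inj₂ (i , j , x)) (inj₂ (i′ , j′ , x′)) refl eq with inTree-injective eq
  ... | refl , leaf≡ with leafAt-injective leaf≡
  ... | refl = refl

  -- Colours and levels of the edges

  tint : Fin σ → Maybe (ℕ × ℕ) → ℕ → ℕ
  tint i (just (c , _)) own = 2 * encode-colour i c
  tint i nothing        own = suc (2 * own)

  colour : GEdge → ℕ
  colour e@(inj₁ (i , d)) = tint i (paint t d) (toℕ (encᵉ e))
  colour e@(inj₂ _)       = suc (2 * toℕ (encᵉ e))

  levelOf : Maybe (ℕ × ℕ) → ℕ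
  levelOf (just (_ , l)) = l
  -- A default: such an edge is alone in its colour, so any level below `Δ` will do.
  levelOf nothing        = 0

  level : GEdge → ℕ
  level (inj₁ (i , d)) = levelOf (paint t d)
  level (inj₂ _)       = 0

  -- The odd colours belong to a single edge each, so only the painted tree edges share colours.
  data Kind : GEdge → Set where
    painted : ∀ i d {c l} → paint t d ≡ just (c , l) → Kind (inj₁ (i , d))
    private-colour : ∀ {e} → colour e ≡ suc (2 * toℕ (encᵉ e)) → Kind e

  kind : ∀ e → Kind e
  kind (inj₁ (i , d)) with paint t d in eq
  ... | just _  = painted i d eq
  ... | nothing = private-colour (cong (λ p → tint i p (toℕ (encᵉ (inj₁ (i , d))))) eq)
  kind (inj₂ _) = private-colour refl

  colour-painted : ∀ i d {c l} → paint t d ≡ just (c , l) → colour (inj₁ (i , d)) ≡ 2 * encode-colour i c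
  colour-painted i d eq = cong (λ p → tint i p (toℕ (encᵉ (inj₁ (i , d))))) eq

  -- An odd colour encodes its edge. An even one encodes the copy and the tree colour, and with the
  -- level `unique` determines the edge.
  key-injective : ∀ e e′ → colour e ≡ colour e′ → level e ≡ level e′ → e ≡ e′
  key-injective e e′ c≡ l≡ with kind e | kind e′
  ... | private-colour p | private-colour q =
    encᵉ-injective (Fin.toℕ-injective (*-cancelˡ-≡ _ _ 2 (suc-injective (trans (sym p) (trans c≡ q)))))
  ... | private-colour p | painted i d {c} q =
    contradiction (trans (sym (colour-painted i d q)) (trans (sym c≡) p)) (even≢odd (encode-colour i c) (toℕ (encᵉ e)))
  ... | painted i d {c} p | private-colour q =
    contradiction (trans (sym (colour-painted i d p)) (trans c≡ q)) (even≢odd (encode-colour i c) (toℕ (encᵉ e′)))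
  ... | painted i d {c} {l} p | painted i′ d′ {c′} {l′} q
    with encode-colour-injective i i′ c c′
           (*-cancelˡ-≡ _ _ 2 (trans (sym (colour-painted i d p)) (trans c≡ (colour-painted i′ d′ q))))
       | trans (sym (cong levelOf p)) (trans l≡ (cong levelOf q))
  ... | refl , refl | refl = cong (λ z → inj₁ (i , z)) (unique rainbow d d′ c l p q)

  level< : ∀ {Δ} → 1 ≤ Δ → f ≤ Δ → ∀ e → level e < Δ
  level< 1≤Δ f≤Δ (inj₂ _) = 1≤Δ
  level< 1≤Δ f≤Δ (inj₁ (i , d)) with paint t d in eq
  ... | nothing      = 1≤Δ
  ... | just (c , l) = <-≤-trans (proj₂ (proj₂ (bounds rainbow d c l eq))) f≤Δ

  toEdge : GEdge → Edge order
  toEdge e = edge (encᵛ (lower e)) (encᵛ (upper e)) (colour e)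

  toEdge-injective : ∀ {e e′} → toEdge e ≡ toEdge e′ → e ≡ e′
  toEdge-injective {e} {e′} eq =
    ends-injective e e′ (encᵛ-injective (cong u eq)) (encᵛ-injective (cong v eq))

  edgeList : List (Edge order)
  edgeList = tabulate (toEdge ∘ decᵉ)

  lower≢upper : ∀ e → lower e ≢ upper e
  lower≢upper e eq = <-irrefl (cong height (sym eq)) (upper<lower e)

  sameEnds⇒≡ : ∀ e e′ → SameEnds (toEdge e) (toEdge e′) → e ≡ e′
  sameEnds⇒≡ e e′ (inj₁ (p , q)) = ends-injective e e′ (encᵛ-injective (sym p)) (encᵛ-injective (sym q))
  sameEnds⇒≡ e e′ (inj₂ (p , q)) = contradiction (upper<lower e) (<⇒≯ lower<upper)
    where
    lower<upper : height (lower e) < height (upper e)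
    lower<upper = subst₂ _<_ (cong height (encᵛ-injective {upper e′} {lower e} q))
                             (cong height (encᵛ-injective {lower e′} {upper e} p)) (upper<lower e′)

  G : ColoredGraph
  G = graph order edgeList
        (All.tabulate⁺ (λ k → lower≢upper (decᵉ k) ∘ encᵛ-injective))
        (AllPairs.tabulate⁺ (λ i≢j same → i≢j (decᵉ-injective (sameEnds⇒≡ _ _ same))))

  colourClass≤ : ∀ {Δ} → 1 ≤ Δ → f ≤ Δ → ∀ c → colorClassSize (E G) c ≤ Δ
  colourClass≤ 1≤Δ f≤Δ = colorClassSize≤ (toEdge ∘ decᵉ) (level ∘ decᵉ) (λ k → level< 1≤Δ f≤Δ (decᵉ k))
    (λ k k′ c≡ l≡ → decᵉ-injective (key-injective (decᵉ k) (decᵉ k′) c≡ l≡))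

  sources : Subset order
  sources = replicate σ true ++ᵛ replicate rest false

  source : Fin σ → Fin order
  source i = encᵛ (inj₁ i)

  source∈ : ∀ i → source i ∈ sources
  source∈ i = lookup⇒[]= (source i) sources
    (trans (lookup-++ˡ (replicate σ true) (replicate rest false) i) (lookup-replicate i true))

  toEdge∈ : ∀ e → toEdge e ∈ᴸ edgeList
  toEdge∈ e = subst (λ z → toEdge z ∈ᴸ edgeList) (dec-encᵉ e) (∈-tabulate⁺ (encᵉ e))

  fault : Fin σ → Fin L → ℕ
  fault i j = 2 * encode-colour i (toℕ j)

  avoids-fault : ∀ i j d → colour (inj₁ (i , d)) ≢ fault i j → hits (toℕ j) (paint t d) ≡ false
  avoids-fault i j d c≢ with paint t d
  ... | nothing      = refl
  ... | just (c , l) = ≢⇒≡ᵇ {c} {toℕ j} λ { refl → c≢ refl }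

  avoids-fault⁻ : ∀ i j d → hits (toℕ j) (paint t d) ≡ false → colour (inj₁ (i , d)) ≢ fault i j
  avoids-fault⁻ i j d eq c≡ with paint t d
  ... | nothing      = even≢odd (encode-colour i (toℕ j)) (toℕ (encᵉ (inj₁ (i , d)))) (sym c≡)
  ... | just (c , l) with encode-colour-injective i i c (toℕ j) (*-cancelˡ-≡ _ _ 2 c≡)
  ... | _ , refl = case trans (sym (≡ᵇ-refl (toℕ j))) eq of λ ()

  ∧-true : ∀ a {b} → not a ∧ b ≡ true → a ≡ false × b ≡ true
  ∧-true false eq = refl , eq

  -- Recursion is on the length `k`, since the parent of an edge is not a structural subterm.
  walkTo : ∀ i j k w → depth t w ≡ k → reached (toℕ j) t w ≡ true →
           Walk edgeList (fault i j) (source i) (encᵛ (inTree i w)) k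
  walkTo i j zero    nothing  eq r = here
  walkTo i j zero    (just e) eq r = case trans (sym (depth-parent t e)) eq of λ ()
  walkTo i j (suc k) (just e) eq r with ∧-true (hits (toℕ j) (paint t e)) (trans (sym (reached-parent (toℕ j) t e)) r)
  ... | h≡ , r′ = walkTo i j k (parent t e) (suc-injective (trans (sym (depth-parent t e)) eq)) r′
                  ▷ (toEdge (inj₁ (i , e)) , toEdge∈ (inj₁ (i , e)) , avoids-fault⁻ i j e h≡ , inj₂ (refl , refl))

  -- Edges contained in every preserver

  module Forced (i : Fin σ) (j : Fin L) (x : Fin n) where

    crossing : GEdge
    crossing = inj₂ (i , j , x)

    d : ℕ
    d = depth t (leafAt j)

    walk : Walk edgeList (fault i j) (source i) (encᵛ (target x)) (suc d)
    walk = walkTo i j d (leafAt j) refl (leafAt-survives j)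
           ▷ (toEdge crossing , toEdge∈ crossing ,
              (λ eq → even≢odd (encode-colour i (toℕ j)) (toℕ (encᵉ crossing)) (sym eq)) , inj₂ (refl , refl))

    inside : Fin σ → Vertex t → Bool
    inside i′ w = does (i′ Fin.≟ i) ∧ reached (toℕ j) t w

    -- The cap `suc d`, also used for other copies and for the part cut off, keeps the values within
    -- one of those of the targets, which are at `suc d` except for `x`.
    treePotential : Fin σ → Vertex t → ℕ
    treePotential i′ w = if inside i′ w then depth t w ⊓ suc d else suc d

    -- A lower bound on the distance from the source once the fault and the edge crossing are removed.
    potential : GVertex → ℕ
    potential (inj₁ i′)              = treePotential i′ nothing
    potential (inj₂ (inj₁ (i′ , e))) = treePotential i′ (just e)
    potential (inj₂ (inj₂ x′))       = if does (x′ Fin.≟ x) then suc (suc d) else suc d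

    potential-inTree : ∀ i′ w → potential (inTree i′ w) ≡ treePotential i′ w
    potential-inTree i′ nothing  = refl
    potential-inTree i′ (just _) = refl

    Close : ℕ → ℕ → Set
    Close a b = a ≤ suc b × b ≤ suc a

    -- In copy `i` a surviving edge has both ends reached or neither. In the first case the depths
    -- differ by one before capping; in the second, and in other copies, both values are `suc d`.
    treeEdge-close : ∀ i′ e → colour (inj₁ (i′ , e)) ≢ fault i j →
                     Close (treePotential i′ (just e)) (treePotential i′ (parent t e))
    treeEdge-close i′ e c≢ with i′ Fin.≟ i
    ... | no _     = n≤1+n _ , n≤1+n _
    ... | yes refl rewrite reached-parent (toℕ j) t e | avoids-fault i j e c≢ with reached (toℕ j) t (parent t e)
    ... | false = n≤1+n _ , n≤1+n _
    ... | true  rewrite depth-parent t e =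
      s≤s (⊓-monoʳ-≤ (depth t (parent t e)) (n≤1+n d)) ,
      ≤-trans (⊓-monoˡ-≤ (suc d) (n≤1+n (depth t (parent t e)))) (n≤1+n _)

    -- A leaf of copy `i` that survives has a label smaller than `j`, hence a depth greater than
    -- `d`, and the cap applies. This is where leaf `j` is the unique closest one.
    other-leaf : ∀ i′ j′ → ¬ (i′ ≡ i × j′ ≡ j) → treePotential i′ (leafAt j′) ≡ suc d
    other-leaf i′ j′ other with i′ Fin.≟ i
    ... | no _ = refl
    ... | yes refl with reached (toℕ j) t (leafAt j′) in r
    ... | false = refl
    ... | true  = m≥n⇒m⊓n≡n (+-cancelʳ-< (toℕ j′) d (depth t (leafAt j′))
          (subst₂ _<_ refl (trans (leafAt-depth j) (sym (leafAt-depth j′)))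
            (+-monoʳ-< d (≤∧≢⇒< (leafAt-cut j′ (toℕ j) r) (λ eq → other (refl , Fin.toℕ-injective eq))))))

    this-leaf : treePotential i (leafAt j) ≡ d
    this-leaf rewrite leafAt-survives j with i Fin.≟ i
    ... | yes _  = m≤n⇒m⊓n≡m (n≤1+n d)
    ... | no i≢i = contradiction refl i≢i

    target-bounds : ∀ x′ → suc d ≤ potential (target x′) × potential (target x′) ≤ suc (suc d)
    target-bounds x′ with does (x′ Fin.≟ x)
    ... | true  = n≤1+n _ , ≤-refl
    ... | false = ≤-refl , n≤1+n _

    potential-target : potential (target x) ≡ suc (suc d)
    potential-target with x Fin.≟ x
    ... | yes _  = refl
    ... | no x≢x = contradiction refl x≢x

    other-target : ∀ x′ → x′ ≢ x → potential (target x′) ≡ suc d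
    other-target x′ x′≢x with x′ Fin.≟ x
    ... | yes eq = contradiction eq x′≢x
    ... | no _   = refl

    -- Only `crossing` spans a gap of two, from `d` to `suc (suc d)`.
    leafEdge-close : ∀ i′ j′ x′ → (i′ , j′ , x′) ≡ (i , j , x) ⊎
                     Close (potential (target x′)) (treePotential i′ (leafAt j′))
    leafEdge-close i′ j′ x′ with (i′ Fin.≟ i) ×-dec (j′ Fin.≟ j)
    ... | no other = inj₂ (subst (Close _) (sym (other-leaf i′ j′ other))
                       (proj₂ (target-bounds x′) , ≤-trans (proj₁ (target-bounds x′)) (n≤1+n _)))
    ... | yes (refl , refl) = same-leaf (x′ Fin.≟ x)
      where
      same-leaf : Dec (x′ ≡ x) → (i , j , x′) ≡ (i , j , x) ⊎ Close (potential (target x′)) (treePotential i (leafAt j))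
      same-leaf (yes refl) = inj₁ refl
      same-leaf (no x′≢x)  = inj₂ (subst₂ Close (sym (other-target x′ x′≢x)) (sym this-leaf)
                       (≤-refl , ≤-trans (n≤1+n d) (n≤1+n (suc d))))

    φ : Fin order → ℕ
    φ = potential ∘ decᵛ

    φ-enc : ∀ y → φ (encᵛ y) ≡ potential y
    φ-enc y = cong potential (dec-encᵛ y)

    lipschitz : ∀ e → e ∈ᴸ edgeList → col e ≢ fault i j →
                e ≡ toEdge crossing ⊎ Close (φ (u e)) (φ (v e))
    lipschitz e e∈ c≢ with ∈-tabulate⁻ e∈
    ... | k , refl = byKind (decᵉ k) c≢
      where
      byKind : ∀ g → colour g ≢ fault i j →
               toEdge g ≡ toEdge crossing ⊎ Close (φ (encᵛ (lower g))) (φ (encᵛ (upper g)))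
      byKind g c≢ rewrite φ-enc (lower g) | φ-enc (upper g) with g
      ... | inj₁ (i′ , b) rewrite potential-inTree i′ (parent t b) = inj₂ (treeEdge-close i′ b c≢)
      ... | inj₂ (i′ , j′ , x′) rewrite potential-inTree i′ (leafAt j′) with leafEdge-close i′ j′ x′
      ...   | inj₁ refl  = inj₁ refl
      ...   | inj₂ close = inj₂ close

    φ-source : φ (source i) ≡ 0
    φ-source = trans (φ-enc (inj₁ i)) root
      where
      root : treePotential i nothing ≡ 0
      root with i Fin.≟ i
      ... | yes _  = refl
      ... | no i≢i = contradiction refl i≢i

    -- `walk` has length `suc d`, so the preserver has a walk at most that long; without `crossing`
    -- the potential would force length at least `suc (suc d)`.
    forced : ∀ {H} → H ⊆ edgeList → IsCFTPreserver G sources H → toEdge crossing ∈ᴸ H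
    forced H⊆E pres
      with Equivalence.from (pres (fault i j) (source i) (encᵛ (target x)) (source∈ i) (suc d)) (suc d , ≤-refl , walk)
    ... | k , k≤ , w with walk-uses φ (toEdge crossing) (λ e e∈ → lipschitz e (Any-resp-⊆ H⊆E e∈)) w
    ... | inj₁ e∈H = e∈H
    ... | inj₂ le  = contradiction k≤ (<⇒≱
          (subst₂ _≤_ (trans (φ-enc (target x)) potential-target) (cong (_+ k) φ-source) le))

  preserver-size : ∀ {H} → H ⊆ edgeList → IsCFTPreserver G sources H → σ * (L * n) ≤ length H
  preserver-size H⊆E pres = injective-members⇒≤ (toEdge ∘ inj₂ ∘ triple)
    (λ eq → triple-injective (inj₂-injective (toEdge-injective eq)))
    (λ k → Forced.forced (proj₁ (triple k)) (proj₁ (proj₂ (triple k))) (proj₂ (proj₂ (triple k))) H⊆E pres)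
    where
    triple↔ : Fin (σ * (L * n)) ↔ (Fin σ × Fin L × Fin n)
    triple↔ = ↔-trans Fin.*↔× (↔-refl ×-↔ Fin.*↔×)
    open Inverse triple↔ using () renaming (to to triple; from to index-of; strictlyInverseʳ to index-of-triple)
    triple-injective : ∀ {k k′} → triple k ≡ triple k′ → k ≡ k′
    triple-injective {k} {k′} eq = trans (sym (index-of-triple k)) (trans (cong index-of eq) (index-of-triple k′))

-- The edge bound is stated as its power of exponent `Δ + 1`, which clears the fractional exponents
-- and the division by `Δ`; `a`, `b` and `c` are the absolute constants hidden in the asymptotic
-- notation.
theorem3p5 : Σ ℕ λ a → Σ ℕ λ b → Σ ℕ λ c →
    ∀ (n Δ σ : ℕ) → 1 ≤ Δ → 1 ≤ σ → σ ≤ n →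
    Σ ColoredGraph λ G → Σ (Subset (N G)) λ S →
    (n ≤ b * N G × N G ≤ a * n)
    × (∀ (col : ℕ) → colorClassSize (E G) col ≤ Δ)
    × ∣ S ∣ ≡ σ
    × (∀ (H : List (Edge (N G))) → H ⊆ E G → IsCFTPreserver G S H →
    n ^ (2 * Δ + 1) * σ ≤ (c * Δ * length H) ^ (Δ + 1))
-- The order is made up of at most `n` roots, `3 * n` lower ends of tree edges and `n` targets; the
-- targets alone give the lower bound. The `8` is that of `edge-bound`.
theorem3p5 = 5 , 1 , 8 , λ n Δ σ 1≤Δ 1≤σ σ≤n →
  let P = parameters n Δ σ 1≤Δ 1≤σ σ≤n
      open Parameters P
      open Construction n σ (product ks) (leafDepth ks) (product ks) (length ks) (faultTree ks 0)
             (graded-faultTree ks 0) (λ ℓ → hasLeaf-faultTree ks 0 ℓ z≤n) (rainbow-faultTree ks 0)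
  in G , sources
   , ( subst (n ≤_) (sym (*-identityˡ order)) (≤-trans (m≤n+m n (σ * size (faultTree ks 0))) (m≤n+m rest σ))
     , ≤-trans (+-mono-≤ σ≤n (+-monoˡ-≤ n (≤-trans (*-monoʳ-≤ σ (size-faultTree ks 0 ks≤D)) room)))
               (≤-reflexive (total n)) )
   , colourClass≤ 1≤Δ len≤Δ
   , ∣replicate-true++false∣ σ rest
   , λ H H⊆E pres → edge-bound P (≤-trans 1≤σ σ≤n) (preserver-size H⊆E pres)
  where
  total : ∀ n → n + (3 * n + n) ≡ 5 * n
  total = solve-∀
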